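{- Let $X$ be a countable, second countable topological space. If $\mathcal{M}(X)\notin\boldsymbol{\Pi}^0_1(\mathcal{P}(X))$ (i.e. $\mathcal{M}(X)$ is not closed in $\mathcal{P}(X)$), then $\mathcal{M}(X)$ is $\boldsymbol{\Sigma}^0_2$-hard.
   Context: "Countable" means countably infinite (the paper writes "at most countable" when finite sets are allowed). For a topological space $X$, a subset $A\subseteq X$ is dense in an open set $U$ if $U\subseteq\overline{A}$, and codense in $U$ if $U\subseteq\overline{X\setminus A}$. A subset $A\subseteq X$ is monitorable if for every non-empty open set $U\subseteq X$ either $A$ is not dense in $U$ or $A$ is not codense in $U$. $\mathcal{M}(X)\subseteq\mathcal{P}(X)$ denotes the family of monitorable subsets of $X$. The powerset $\mathcal{P}(X)$ is identified with $2^X$ via characteristic functions and carries the product topology (with $2=\{0,1\}$ discrete); for countable $X$ it is homeomorphic to the Cantor space. $\boldsymbol{\Sigma}^0_1(Z)$ and $\boldsymbol{\Pi}^0_1(Z)$ are the families of open and closed sets of $Z$, and $\boldsymbol{\Sigma}^0_2(Z)$ is the family of at most countable unions of closed sets of $Z$. For a boldface pointclass $\boldsymbol{\Gamma}$ and a Polish space $Z$, a set $A\subseteq Z$ is $\boldsymbol{\Gamma}$-hard if for every zero-dimensional Polish space $Y$ and every $B\in\boldsymbol{\Gamma}(Y)$ there is a continuous function $f:Y\to Z$ with $B=f^{ -1}(A)$. -}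

-- Point-set topology and Polish spaces, set up for classical use.
--
-- Nothing here assumes a classical principle; results about these notions are
-- meant to be stated under `ExcludedMiddle (suc 0ℓ)`.  As that decides every
-- type in Set₁, and not only the propositions, it also yields countable choice
-- and lets every predicate valued in Set₁ be replaced by an equivalent one
-- valued in Set.  Hence working with opens in `Pred X 0ℓ` and with unions
-- indexed by small types loses no open set.

module Defs where

open import Level using (Level; 0ℓ; suc; _⊔_; Lift)
open import Data.Bool.Base using (Bool; true)
open import Data.List.Base using (List; []; _++_)
import Data.List.Membership.Propositional as List
open import Data.List.Membership.Propositional.Properties using (∈-++⁺ˡ; ∈-++⁺ʳ)
open import Data.Nat.Base as ℕ using (ℕ)
open import Data.Product.Base using (Σ; ∃; ∃-syntax; Σ-syntax; _×_; _,_; proj₁; proj₂)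
open import Data.Rational.Base as ℚ using (ℚ; 0ℚ; 1ℚ)
import Data.Rational.Properties as ℚ
open import Data.Sum.Base using (_⊎_)
open import Data.Unit.Base using (⊤; tt)
open import Function.Base using (_∘_)
open import Function.Bundles using (_⇔_; _⤖_)
open import Function.Metric.Structures using (IsGeneralMetric)
open import Relation.Binary.Definitions using (tri<; tri≈; tri>)
open import Relation.Binary.PropositionalEquality
  using (_≡_; refl; sym; trans; cong; subst)
open import Relation.Nullary.Negation using (¬_; contradiction)
open import Relation.Unary
  using (Pred; _∈_; _∉_; _⊆_; _≐_; _∩_; ∁; U; ⋃; Satisfiable; _⊢_)

private
  variable
    a b : Level

------------------------------------------------------------------------
-- Topological spaces

-- The empty set is the union of the empty family.
record Space : Set (suc (suc 0ℓ)) where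
  field
    Carrier : Set
    IsOpen  : Pred (Pred Carrier 0ℓ) (suc 0ℓ)
    open-resp-≐ : ∀ {V W} → V ≐ W → IsOpen V → IsOpen W
    open-U      : IsOpen U
    open-∩      : ∀ {V W} → IsOpen V → IsOpen W → IsOpen (V ∩ W)
    open-⋃      : ∀ (I : Set) (V : I → Pred Carrier 0ℓ) →
                  (∀ i → IsOpen (V i)) → IsOpen (⋃ I V)

open Space public using (Carrier; IsOpen)

-- Openness of a subset given by a predicate of any level: it has the same
-- points as an element of the topology.
Open : (X : Space) → Pred (Carrier X) a → Set (suc 0ℓ ⊔ a)
Open X A = Σ[ V ∈ Pred (Carrier X) 0ℓ ] (IsOpen X V × V ≐ A)

Closed : (X : Space) → Pred (Carrier X) a → Set (suc 0ℓ ⊔ a)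
Closed X A = Open X (∁ A)

Continuous : (Y Z : Space) → (Carrier Y → Carrier Z) → Set (suc 0ℓ)
Continuous Y Z f = ∀ V → IsOpen Z V → IsOpen Y (f ⊢ V)

closure : (X : Space) → Pred (Carrier X) a → Pred (Carrier X) (suc 0ℓ ⊔ a)
closure X A x = ∀ V → IsOpen X V → x ∈ V → ∃[ y ] (y ∈ V × y ∈ A)

DenseIn : (X : Space) → Pred (Carrier X) a → Pred (Carrier X) b → Set (suc 0ℓ ⊔ a ⊔ b)
DenseIn X A V = V ⊆ closure X A

CodenseIn : (X : Space) → Pred (Carrier X) a → Pred (Carrier X) b → Set (suc 0ℓ ⊔ a ⊔ b)
CodenseIn X A V = V ⊆ closure X (∁ A)

CountablyInfinite : Set → Set
CountablyInfinite X = ℕ ⤖ X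

AtMostCountable : {X : Set} → Pred X 0ℓ → Set
AtMostCountable {X} D =
  Σ[ f ∈ (X → ℕ) ] (∀ {x y} → x ∈ D → y ∈ D → f x ≡ f y → x ≡ y)

-- The enumeration may repeat and may list the empty set, so finite bases are
-- included.
SecondCountable : Space → Set (suc 0ℓ)
SecondCountable X =
  Σ[ B ∈ (ℕ → Pred (Carrier X) 0ℓ) ]
    ((∀ n → IsOpen X (B n)) ×
     (∀ V → IsOpen X V → ∀ x → x ∈ V → ∃[ n ] (x ∈ B n × B n ⊆ V)))

------------------------------------------------------------------------
-- Discrete and product topologies

discrete : Set → Space
discrete A = record
  { Carrier     = A
  ; IsOpen      = λ _ → Lift (suc 0ℓ) ⊤
  ; open-resp-≐ = λ _ o → o
  ; open-U      = _
  ; open-∩      = λ _ _ → _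
  ; open-⋃      = λ _ _ _ → _
  }

module _ {I : Set} (Z : I → Space) where

  -- The basic open sets are the boxes ∏ᵢ Vᵢ with every Vᵢ open and Vᵢ the
  -- whole space for all i outside some finite list.
  record Box : Set (suc 0ℓ) where
    field
      side      : ∀ i → Pred (Carrier (Z i)) 0ℓ
      side-open : ∀ i → IsOpen (Z i) (side i)
      support   : List I
      side-full : ∀ i → ¬ (i List.∈ support) → side i ≐ U

    ⟦_⟧ : Pred (∀ i → Carrier (Z i)) 0ℓ
    ⟦_⟧ f = ∀ i → f i ∈ side i

  open Box

  private
    Boxy : Pred (Pred (∀ i → Carrier (Z i)) 0ℓ) (suc 0ℓ)
    Boxy V = ∀ f → f ∈ V → Σ[ β ∈ Box ] (f ∈ ⟦ β ⟧ × ⟦ β ⟧ ⊆ V)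

    fullBox : Box
    fullBox .side _ = U
    fullBox .side-open i = Space.open-U (Z i)
    fullBox .support = []
    fullBox .side-full _ _ = (λ z → z) , (λ z → z)

    meet : Box → Box → Box
    meet β γ .side i = side β i ∩ side γ i
    meet β γ .side-open i = Space.open-∩ (Z i) (side-open β i) (side-open γ i)
    meet β γ .support = support β ++ support γ
    meet β γ .side-full i i∉ =
      _ , λ _ → proj₂ (side-full β i (i∉ ∘ ∈-++⁺ˡ)) _
              , proj₂ (side-full γ i (i∉ ∘ ∈-++⁺ʳ (support β))) _

    Boxy-∩ : ∀ {V W} → Boxy V → Boxy W → Boxy (V ∩ W)
    Boxy-∩ oV oW f (fV , fW) with oV f fV | oW f fW
    ... | β , fβ , β⊆V | γ , fγ , γ⊆W =
      meet β γ , (λ i → fβ i , fγ i)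
               , λ g∈ → β⊆V (proj₁ ∘ g∈) , γ⊆W (proj₂ ∘ g∈)

    Boxy-⋃ : ∀ J (V : J → _) → (∀ j → Boxy (V j)) → Boxy (⋃ J V)
    Boxy-⋃ J V oV f (j , fVj) with oV j f fVj
    ... | β , fβ , β⊆V = β , fβ , λ g∈ → j , β⊆V g∈

  Product : Space
  Product = record
    { Carrier     = ∀ i → Carrier (Z i)
    ; IsOpen      = λ V → ∀ f → f ∈ V → Σ[ β ∈ Box ] (f ∈ ⟦ β ⟧ × ⟦ β ⟧ ⊆ V)
    ; open-resp-≐ = λ (V⊆W , W⊆V) oV f fW →
        let β , fβ , β⊆V = oV f (W⊆V fW) in β , fβ , V⊆W ∘ β⊆V
    ; open-U      = λ _ _ → fullBox , (λ _ → tt) , (λ _ → tt)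
    ; open-∩      = Boxy-∩
    ; open-⋃      = Boxy-⋃
    }

𝒫 : Set → Space
𝒫 X = Product {X} (λ _ → discrete Bool)

-- The subset of X with the given characteristic function.
⟪_⟫ : {X : Set} → Carrier (𝒫 X) → Pred X 0ℓ
⟪ χ ⟫ x = χ x ≡ true

------------------------------------------------------------------------
-- Monitorable sets

Monitorable : (X : Space) → Pred (Carrier X) a → Set (suc 0ℓ ⊔ a)
Monitorable X A = ∀ V → IsOpen X V → Satisfiable V →
                  ¬ DenseIn X A V ⊎ ¬ CodenseIn X A V

ℳ : (X : Space) → Pred (Carrier (𝒫 (Carrier X))) (suc 0ℓ)
ℳ X χ = Monitorable X ⟪ χ ⟫

------------------------------------------------------------------------
-- Real numbers

-- Dedekind cuts, identified with their lower parts.  Without locatedness this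
-- is the usual notion only classically.
record ℝ : Set (suc 0ℓ) where
  field
    cut       : Pred ℚ 0ℓ
    inhabited : ∃[ q ] q ∈ cut
    bounded   : ∃[ q ] q ∉ cut
    downward  : ∀ {p q} → p ℚ.< q → q ∈ cut → p ∈ cut
    rounded   : ∀ {p} → p ∈ cut → ∃[ q ] (p ℚ.< q × q ∈ cut)

open ℝ public

infix 4 _≈ᴿ_ _≤ᴿ_ _<ᴿ_
infixl 6 _+ᴿ_

_≈ᴿ_ _≤ᴿ_ _<ᴿ_ : ℝ → ℝ → Set
x ≈ᴿ y = cut x ≐ cut y
x ≤ᴿ y = cut x ⊆ cut y
x <ᴿ y = ∃[ q ] (q ∉ cut x × q ∈ cut y)

0ᴿ : ℝ
0ᴿ .cut p = p ℚ.< 0ℚ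
0ᴿ .inhabited = ℚ.- 1ℚ , ℚ.neg-antimono-< (ℚ.positive⁻¹ 1ℚ)
0ᴿ .bounded = 0ℚ , ℚ.<-irrefl refl
0ᴿ .downward = ℚ.<-trans
0ᴿ .rounded = ℚ.<-dense

private
  below : ∀ x {p q} → p ∈ cut x → q ∉ cut x → p ℚ.< q
  below x {p} {q} p∈ q∉ with ℚ.<-cmp p q
  ... | tri< p<q _ _ = p<q
  ... | tri≈ _ refl _ = contradiction p∈ q∉
  ... | tri> _ _ q<p = contradiction (downward x q<p p∈) q∉

  cancel : ∀ r s → (ℚ.- r) ℚ.+ (r ℚ.+ s) ≡ s
  cancel r s = trans (sym (ℚ.+-assoc (ℚ.- r) r s))
    (trans (cong (ℚ._+ s) (ℚ.+-inverseˡ r)) (ℚ.+-identityˡ s))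

  cancel′ : ∀ r s → s ≡ r ℚ.+ ((ℚ.- r) ℚ.+ s)
  cancel′ r s = sym (trans (sym (ℚ.+-assoc r (ℚ.- r) s))
    (trans (cong (ℚ._+ s) (ℚ.+-inverseʳ r)) (ℚ.+-identityˡ s)))

_+ᴿ_ : ℝ → ℝ → ℝ
(x +ᴿ y) .cut p = ∃[ r ] ∃[ s ] (r ∈ cut x × s ∈ cut y × p ≡ r ℚ.+ s)
(x +ᴿ y) .inhabited with inhabited x | inhabited y
... | r , r∈ | s , s∈ = r ℚ.+ s , r , s , r∈ , s∈ , refl
(x +ᴿ y) .bounded with bounded x | bounded y
... | p , p∉ | q , q∉ = p ℚ.+ q , λ (r , s , r∈ , s∈ , eq) →
  ℚ.<-irrefl (sym eq) (ℚ.+-mono-< (below x r∈ p∉) (below y s∈ q∉))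
(x +ᴿ y) .downward {p} p<q (r , s , r∈ , s∈ , refl) =
  r , (ℚ.- r) ℚ.+ p , r∈ ,
  downward y (subst ((ℚ.- r) ℚ.+ p ℚ.<_) (cancel r s) (ℚ.+-monoʳ-< (ℚ.- r) p<q)) s∈ ,
  cancel′ r p
(x +ᴿ y) .rounded (r , s , r∈ , s∈ , refl) with rounded x r∈
... | r′ , r<r′ , r′∈ = r′ ℚ.+ s , ℚ.+-monoˡ-< s r<r′ , r′ , s , r′∈ , s∈ , refl

------------------------------------------------------------------------
-- Zero-dimensional Polish spaces

IsMetric : {Y : Set} → (Y → Y → ℝ) → Set (suc 0ℓ)
IsMetric = IsGeneralMetric _≡_ _≈ᴿ_ _≤ᴿ_ 0ᴿ _+ᴿ_

module _ {Y : Set} (d : Y → Y → ℝ) where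

  ball : Y → ℝ → Pred Y 0ℓ
  ball x ε y = d x y <ᴿ ε

  Cauchy : (ℕ → Y) → Set (suc 0ℓ)
  Cauchy s = ∀ ε → 0ᴿ <ᴿ ε →
    ∃[ N ] (∀ m n → N ℕ.≤ m → N ℕ.≤ n → d (s m) (s n) <ᴿ ε)

  ConvergesTo : (ℕ → Y) → Y → Set (suc 0ℓ)
  ConvergesTo s x = ∀ ε → 0ᴿ <ᴿ ε → ∃[ N ] (∀ n → N ℕ.≤ n → d (s n) x <ᴿ ε)

  Complete : Set (suc 0ℓ)
  Complete = ∀ s → Cauchy s → ∃[ x ] ConvergesTo s x

Metrizes : (Y : Space) → (Carrier Y → Carrier Y → ℝ) → Set (suc 0ℓ)
Metrizes Y d = ∀ V →
  IsOpen Y V ⇔ (∀ x → x ∈ V → Σ[ ε ∈ ℝ ] (0ᴿ <ᴿ ε × ball d x ε ⊆ V))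

CompletelyMetrizable : Space → Set (suc 0ℓ)
CompletelyMetrizable Y =
  Σ[ d ∈ (Carrier Y → Carrier Y → ℝ) ] (IsMetric d × Complete d × Metrizes Y d)

Separable : Space → Set (suc 0ℓ)
Separable Y = Σ[ D ∈ Pred (Carrier Y) 0ℓ ] (AtMostCountable D × DenseIn Y D U)

Polish : Space → Set (suc 0ℓ)
Polish Y = Separable Y × CompletelyMetrizable Y

ZeroDimensional : Space → Set (suc 0ℓ)
ZeroDimensional Y = ∀ V → IsOpen Y V → ∀ x → x ∈ V →
  Σ[ C ∈ Pred (Carrier Y) 0ℓ ] (IsOpen Y C × Closed Y C × x ∈ C × C ⊆ V)

------------------------------------------------------------------------
-- Pointclasses and hardness

Pointclass : Set (suc (suc 0ℓ))
Pointclass = (Y : Space) → Pred (Pred (Carrier Y) 0ℓ) (suc 0ℓ)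

-- Since ∅ is closed, unions of ℕ-indexed families are exactly the at most
-- countable unions.
𝚺⁰₂ : Pointclass
𝚺⁰₂ Y B = Σ[ F ∈ (ℕ → Pred (Carrier Y) 0ℓ) ] ((∀ n → Closed Y (F n)) × B ≐ ⋃ ℕ F)

Hard : Pointclass → (Z : Space) → Pred (Carrier Z) a → Set (suc (suc 0ℓ) ⊔ a)
Hard 𝚪 Z A = ∀ (Y : Space) → Polish Y → ZeroDimensional Y →
  ∀ (B : Pred (Carrier Y) 0ℓ) → 𝚪 Y B →
  Σ[ f ∈ (Carrier Y → Carrier Z) ] (Continuous Y Z f × B ≐ (f ⊢ A))

-- If ℳ(X) is not closed, some set A is dense and codense in a non-empty open W
-- without minimal non-empty open subsets, as two points of a minimal one would
-- separate A from ℳ(X).  From this one gets a possibly smaller W and D ⊆ W, dense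
-- and codense in W, all of whose points can be avoided by shrinking open subsets
-- of W.  So finite subsets of D are monitorable, while a subset of D that is
-- dense in W is not, and D has infinitely many points in
-- each non-empty open subset of W.
-- Collect, for every n in a set h ⊆ ℕ, points of D with index beyond n from each
-- of the first n + 1 members of a π-base of W: the result is monitorable iff h
-- is finite.  It remains to reduce a given 𝚺⁰₂ set of a zero-dimensional
-- Polish space to finiteness of a set h of naturals, which a counter does that
-- passes from n to n + 1 when the point is seen to be outside the n-th closed set.

module Submission where

open import Defs
open import Level using (0ℓ; suc; lift; lower)
open import Axiom.ExcludedMiddle using (ExcludedMiddle)
open import Relation.Nullary.Negation using (¬_; contradiction)
open import Data.Bool.Base using (Bool; true; false; T; not; _∧_; _∨_; if_then_else_)
open import Data.Bool.Properties using (T-∧; T-∨; T-≡)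
import Data.Integer.Base as ℤ
import Data.Integer.Properties as ℤ
open import Data.List.Base using ([]; _∷_)
open import Data.List.Membership.Propositional using () renaming (_∈_ to _∈ᴸ_)
open import Data.List.Relation.Unary.Any using (here; there)
open import Data.Nat.Base using (ℕ; zero; _+_; _≤_; _<_; _⊔_; z≤n; s≤s)
  renaming (suc to 1+)
open import Data.Nat.Coprimality using (1-coprimeTo)
import Data.Nat.Properties as ℕ
open import Data.Product.Base using (∃; Σ-syntax; ∃-syntax; _×_; _,_; proj₁; proj₂)
open import Data.Rational.Base as ℚ using (ℚ; mkℚ; 0ℚ; 1ℚ; ½)
import Data.Rational.Properties as ℚ
open import Data.Sum.Base using (_⊎_; inj₁; inj₂; [_,_]′)
open import Data.Unit.Base using (tt)
open import Function.Base using (_∘_; id)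
open import Function.Bundles using (Bijection; module Equivalence)
open import Function.Metric.Structures using (module IsGeneralMetric)
open import Relation.Binary.Definitions using (tri<; tri≈; tri>)
open import Relation.Binary.PropositionalEquality
  using (_≡_; refl; sym; trans; cong; subst)
open import Relation.Nullary.Decidable
  using (yes; no; does; map′; decidable-stable; dec-true; dec-false; isYes≗does;
    toWitness; fromWitness; ⌊_⌋)
open import Relation.Unary
  using (Pred; _∈_; _∉_; _⊆_; _∩_; U; Satisfiable)

open Equivalence using (to; from)

-- A counter machine

any< : ℕ → (ℕ → Bool) → Bool
any< zero   p = false
any< (1+ k) p = p k ∨ any< k p

any<⁺ : ∀ {k i} (p : ℕ → Bool) → i < k → T (p i) → T (any< k p)
any<⁺ {1+ k} {i} p i<1+k pi with ℕ.m≤n⇒m<n∨m≡n (ℕ.≤-pred i<1+k)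
... | inj₁ i<k  = from T-∨ (inj₂ (any<⁺ p i<k pi))
... | inj₂ refl = from T-∨ (inj₁ pi)

any<⁻ : ∀ k (p : ℕ → Bool) → T (any< k p) → ∃[ i ] (i < k × T (p i))
any<⁻ (1+ k) p h with to T-∨ h
... | inj₁ pk = k , ℕ.n<1+n k , pk
... | inj₂ h′ with any<⁻ k p h′
...   | i , i<k , pi = i , ℕ.m≤n⇒m≤1+n i<k , pi

upperBound : (g : ℕ → ℕ) → ∀ N → ∃[ M ] ∀ n → n < N → g n < M
upperBound g zero = 0 , λ _ ()
upperBound g (1+ N) with upperBound g N
... | M , g<M = M ⊔ 1+ (g N) , λ n n<1+N →
  [ (λ n<N → ℕ.≤-trans (g<M n n<N) (ℕ.m≤m⊔n M _))
  , (λ { refl → ℕ.m≤n⊔m M _ }) ]′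
  (ℕ.m≤n⇒m<n∨m≡n (ℕ.≤-pred n<1+N))

-- The state is the row n of c currently searched for a k with c n k; time t
-- looks at the entries k < t, and is a hit if it finds one and moves on.
state : (ℕ → ℕ → Bool) → ℕ → ℕ
hit   : (ℕ → ℕ → Bool) → ℕ → Bool
state c zero   = 0
state c (1+ t) = if hit c t then 1+ (state c t) else state c t
hit c t = any< t (c (state c t))

Infinite : (ℕ → Bool) → Set
Infinite h = ∀ N → ∃[ t ] (N ≤ t × T (h t))

Finite : (ℕ → Bool) → Set
Finite h = ∃[ N ] ∀ t → N ≤ t → ¬ T (h t)

module _ (c : ℕ → ℕ → Bool) where

  state-step : ∀ t → (T (hit c t) × state c (1+ t) ≡ 1+ (state c t))
                   ⊎ (¬ T (hit c t) × state c (1+ t) ≡ state c t)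
  state-step t with hit c t
  ... | true  = inj₁ (tt , refl)
  ... | false = inj₂ (id , refl)

  state-constant : ∀ N → (∀ t → N ≤ t → ¬ T (hit c t)) → ∀ k → state c (k + N) ≡ state c N
  state-constant N none zero = refl
  state-constant N none (1+ k) with state-step (k + N)
  ... | inj₁ (h , _)  = contradiction h (none _ (ℕ.m≤n+m N k))
  ... | inj₂ (_ , eq) = trans eq (state-constant N none k)

  -- With no hits from time `N` on, the counter stays at row `state c N`. A true entry `k` of that
  -- row is seen at any time beyond both `k` and `N`, which would be a hit.
  solvable⇒¬finite : (∀ n → ∃[ k ] T (c n k)) → ¬ Finite (hit c)
  solvable⇒¬finite solve (N , none) with solve (state c N)
  ... | k , ck = none t (ℕ.≤-trans (ℕ.m≤n+m N k) (ℕ.n≤1+n _))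
                   (any<⁺ (c (state c t)) k<t (subst (λ s → T (c s k)) (sym stuck) ck))
    where
    t = 1+ (k + N)
    k<t : k < t
    k<t = s≤s (ℕ.m≤m+n k N)
    stuck : state c t ≡ state c N
    stuck = state-constant N none (1+ k)

  -- Passing row `n` takes a true entry in it, and the counter climbs one row at a time.
  state-≤ : ∀ {n} → (∀ k → ¬ T (c n k)) → ∀ t → state c t ≤ n
  state-≤ fail zero = z≤n
  state-≤ {n} fail (1+ t) with state-step t
  ... | inj₂ (_ , eq) = subst (_≤ n) (sym eq) (state-≤ fail t)
  ... | inj₁ (h , eq) with ℕ.m≤n⇒m<n∨m≡n (state-≤ fail t)
  ...   | inj₁ s<n  = subst (_≤ n) (sym eq) s<n
  ...   | inj₂ refl = let k , _ , ck = any<⁻ t (c (state c t)) h in contradiction ck (fail k)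

  infinite⇒unbounded : Infinite (hit c) → ∀ m → ∃[ t ] m ≤ state c t
  infinite⇒unbounded inf zero = 0 , z≤n
  infinite⇒unbounded inf (1+ m) with infinite⇒unbounded inf m
  ... | t , m≤ with inf t
  ...   | u , t≤u , h with state-step u
  ...     | inj₁ (_ , eq) = 1+ u , subst (1+ m ≤_) (sym eq) (s≤s (ℕ.≤-trans m≤ (monotone t≤u)))
    where
    step : ∀ t → state c t ≤ state c (1+ t)
    step t with state-step t
    ... | inj₁ (_ , eq) = subst (state c t ≤_) (sym eq) (ℕ.n≤1+n _)
    ... | inj₂ (_ , eq) = ℕ.≤-reflexive (sym eq)
    monotone : ∀ {t u} → t ≤ u → state c t ≤ state c u
    monotone {t} {u} t≤u with ℕ.m≤n⇒m<n∨m≡n t≤u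
    monotone {t} {1+ u} _ | inj₁ t<1+u = ℕ.≤-trans (monotone (ℕ.≤-pred t<1+u)) (step u)
    ... | inj₂ refl = ℕ.≤-refl
  ...     | inj₂ (¬h , _) = contradiction h ¬h

  unsolvable⇒¬infinite : ∀ {n} → (∀ k → ¬ T (c n k)) → ¬ Infinite (hit c)
  unsolvable⇒¬infinite {n} fail inf with infinite⇒unbounded inf (1+ n)
  ... | t , n<s = ℕ.<⇒≱ n<s (state-≤ fail t)

-- Rational radii

rational : ℚ → ℝ
rational q .cut p = p ℚ.< q
rational q .inhabited = q ℚ.+ ℚ.- 1ℚ ,
  subst (q ℚ.+ ℚ.- 1ℚ ℚ.<_) (ℚ.+-identityʳ q)
    (ℚ.+-monoʳ-< q (ℚ.neg-antimono-< (ℚ.positive⁻¹ 1ℚ)))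
rational q .bounded = q , ℚ.<-irrefl refl
rational q .downward = ℚ.<-trans
rational q .rounded = ℚ.<-dense

∉-cut⇒< : ∀ x {p q} → p ∉ cut x → q ∈ cut x → q ℚ.< p
∉-cut⇒< x {p} {q} p∉ q∈ with ℚ.<-cmp q p
... | tri< q<p _ _  = q<p
... | tri≈ _ refl _ = contradiction q∈ p∉
... | tri> _ _ p<q  = contradiction (downward x p<q q∈) p∉

∉-cut-mono : ∀ x {p q} → p ℚ.≤ q → p ∉ cut x → q ∉ cut x
∉-cut-mono x p≤q p∉ q∈ = ℚ.<-irrefl refl (ℚ.<-≤-trans (∉-cut⇒< x p∉ q∈) p≤q)

positive-rational : ∀ ε → 0ᴿ <ᴿ ε → ∃[ q ] (0ℚ ℚ.< q × q ∈ cut ε)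
positive-rational ε (p , p≮0 , p∈) with rounded ε p∈
... | q , p<q , q∈ = q , ℚ.≤-<-trans (ℚ.≮⇒≥ p≮0) p<q , q∈

-- Opaque, since normalising sums of these fractions unfolds their gcds.
opaque
  unitFraction : ℕ → ℚ
  unitFraction k = mkℚ (ℤ.+ 1) k (1-coprimeTo (1+ k))

  unitFraction-positive : ∀ k → 0ℚ ℚ.< unitFraction k
  unitFraction-positive k = ℚ.positive⁻¹ (unitFraction k)

  unitFraction-small : ∀ {q} → 0ℚ ℚ.< q → ∃[ k ] unitFraction k ℚ.≤ q
  unitFraction-small {q} 0<q with q | ℚ.positive 0<q
  ... | mkℚ (ℤ.+ (1+ m)) k _ | _ = k ,
    ℚ.*≤* (ℤ.*-monoʳ-≤-nonNeg (ℤ.+ (1+ k)) {ℤ.+ 1} {ℤ.+ (1+ m)} (ℤ.+≤+ (s≤s z≤n)))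

halve : ∀ {q} → 0ℚ ℚ.< q → ∃[ k ] unitFraction k ℚ.+ unitFraction k ℚ.≤ q
halve {q} 0<q with unitFraction-small 0<q/2
  where
  0<q/2 : 0ℚ ℚ.< ½ ℚ.* q
  0<q/2 = subst (ℚ._< ½ ℚ.* q) (ℚ.*-zeroʳ ½) (ℚ.*-monoʳ-<-pos ½ 0<q)
... | k , u≤ = k , ℚ.≤-trans (ℚ.+-mono-≤ u≤ u≤)
  (ℚ.≤-reflexive (trans (sym (ℚ.*-distribʳ-+ q ½ ½)) (ℚ.*-identityˡ q)))

-- Locally constant functions

module _ (Y : Space) where

  -- Continuity into the discrete space `A`, in a form that passes through finite computations by
  -- intersecting neighbourhoods.
  LocallyConstant : {A : Set} → (Carrier Y → A) → Set₁
  LocallyConstant g = ∀ y → Σ[ V ∈ Pred (Carrier Y) 0ℓ ]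
    (IsOpen Y V × y ∈ V × (∀ {z} → z ∈ V → g z ≡ g y))

  local⇒open : (V : Pred (Carrier Y) 0ℓ) →
    (∀ y → y ∈ V → Σ[ W ∈ Pred (Carrier Y) 0ℓ ] (IsOpen Y W × y ∈ W × W ⊆ V)) → IsOpen Y V
  local⇒open V nbhd = Space.open-resp-≐ Y
    ((λ ((y , y∈V) , z∈W) → proj₂ (proj₂ (proj₂ (nbhd y y∈V))) z∈W) ,
     (λ {y} y∈V → (y , y∈V) , proj₁ (proj₂ (proj₂ (nbhd y y∈V)))))
    (Space.open-⋃ Y (∃ V) (λ (y , y∈V) → proj₁ (nbhd y y∈V))
      (λ (y , y∈V) → proj₁ (proj₂ (nbhd y y∈V))))

  module _ {A : Set} where

    LC-const : (a : A) → LocallyConstant (λ _ → a)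
    LC-const a y = U , Space.open-U Y , tt , λ _ → refl

    -- Near `y` the value of `s` is frozen, so only one `g a` matters. This covers the row being
    -- searched, which itself depends on the point.
    LC-bind : {B : Set} {s : Carrier Y → A} {g : A → Carrier Y → B} → LocallyConstant s →
      (∀ a → LocallyConstant (g a)) → LocallyConstant (λ y → g (s y) y)
    LC-bind {s = s} {g} ls lg y with ls y | lg (s y) y
    ... | V , oV , yV , cV | W , oW , yW , cW =
      V ∩ W , Space.open-∩ Y oV oW , (yV , yW) ,
      λ {z} (zV , zW) → trans (cong (λ a → g a z) (cV zV)) (cW zW)

    LC-map : {B : Set} (k : A → B) {s : Carrier Y → A} → LocallyConstant s → LocallyConstant (k ∘ s)
    LC-map k ls y with ls y
    ... | V , oV , yV , cV = V , oV , yV , cong k ∘ cV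

  LC-any< : ∀ k {p : ℕ → Carrier Y → Bool} → (∀ i → LocallyConstant (p i)) →
    LocallyConstant (λ y → any< k (λ i → p i y))
  LC-any< zero   lp = LC-const false
  LC-any< (1+ k) lp = LC-bind (lp k) (λ b → LC-map (b ∨_) (LC-any< k lp))

  module _ (c : ℕ → ℕ → Carrier Y → Bool) (lc : ∀ n k → LocallyConstant (c n k)) where

    LC-state : ∀ t → LocallyConstant (λ y → state (λ n k → c n k y) t)
    LC-hit   : ∀ t → LocallyConstant (λ y → hit (λ n k → c n k y) t)
    LC-state zero   = LC-const 0
    LC-state (1+ t) = LC-bind (LC-hit t) (λ h → LC-map (λ s → if h then 1+ s else s) (LC-state t))
    LC-hit t = LC-bind (LC-state t) (λ s → LC-any< t (lc s))

-- Classical reasoning about finiteness, continuity and open sets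

module Classical (em : ExcludedMiddle (suc 0ℓ)) where

  em₀ : ExcludedMiddle 0ℓ
  em₀ = map′ lower lift em

  stable : {P : Set₁} → ¬ ¬ P → P
  stable = decidable-stable em

  stable₀ : {P : Set} → ¬ ¬ P → P
  stable₀ = decidable-stable em₀

  ¬finite⇒infinite : ∀ {h} → ¬ Finite h → Infinite h
  ¬finite⇒infinite ¬fin N = stable₀ λ none → ¬fin (N , λ t N≤t ht → none (t , N≤t , ht))

  ¬infinite⇒finite : ∀ {h} → ¬ Infinite h → Finite h
  ¬infinite⇒finite ¬inf = stable₀ (¬inf ∘ ¬finite⇒infinite)

  -- A box constrains only the coordinates in its finite support, so finitely many neighbourhoods
  -- are intersected.
  LC⇒continuous : (Y : Space) {X : Set} (f : Carrier Y → X → Bool) →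
    (∀ x → LocallyConstant Y (λ y → f y x)) → Continuous Y (𝒫 X) f
  LC⇒continuous Y f lf V oV = local⇒open Y _ λ y fy∈V →
    let β , fy∈β , β⊆V = oV (f y) fy∈V
        W , oW , yW , agree = near y (Box.support β)
    in W , oW , yW , λ {z} zW → β⊆V λ x → box β fy∈β (agree zW) x
    where
    near : ∀ y L → Σ[ W ∈ Pred (Carrier Y) 0ℓ ]
      (IsOpen Y W × y ∈ W × (∀ {z} → z ∈ W → ∀ {x} → x ∈ᴸ L → f z x ≡ f y x))
    near y [] = U , Space.open-U Y , tt , λ _ ()
    near y (x ∷ L) with lf x y | near y L
    ... | V , oV , yV , cV | W , oW , yW , cW = V ∩ W , Space.open-∩ Y oV oW , (yV , yW) ,
      λ { (zV , zW) (here refl) → cV zV ; (zV , zW) (there x∈) → cW zW x∈ }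
    box : ∀ β {y z} → f y ∈ Box.⟦_⟧ β →
      (∀ {x} → x ∈ᴸ Box.support β → f z x ≡ f y x) → f z ∈ Box.⟦_⟧ β
    box β fy∈ agree x with em₀ {x ∈ᴸ Box.support β}
    ... | yes x∈ = subst (_∈ Box.side β x) (sym (agree x∈)) (fy∈ x)
    ... | no  x∉ = proj₂ (Box.side-full β x x∉) tt

  -- Open sets of zero-dimensional Polish spaces

  module _ (Y : Space) (polish : Polish Y) (zero-dim : ZeroDimensional Y) where
    private
      D = proj₁ (proj₁ polish)
      code = proj₁ (proj₁ (proj₂ (proj₁ polish)))
      code-injective = proj₂ (proj₁ (proj₂ (proj₁ polish)))
      dense = proj₂ (proj₂ (proj₁ polish))
      d = proj₁ (proj₂ polish)
      metric = proj₁ (proj₂ (proj₂ polish))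
      metrizes = proj₂ (proj₂ (proj₂ (proj₂ polish)))
      open IsGeneralMetric metric using (triangle; ≈⇒0) renaming (sym to d-sym)

      -- Reals are lower cuts, so `q ∉ cut (d x y)` says that the distance is at most `q`.
      closedBall : ℚ → Carrier Y → Pred (Carrier Y) 0ℓ
      closedBall q x y = q ∉ cut (d x y)

      closedBall-triangle : ∀ {p q x y z} →
        y ∈ closedBall p x → z ∈ closedBall q y → z ∈ closedBall (p ℚ.+ q) x
      closedBall-triangle {x = x} {y} {z} p∉ q∉ p+q∈ with triangle x y z p+q∈
      ... | r , s , r∈ , s∈ , eq =
        ℚ.<-irrefl (sym eq) (ℚ.+-mono-< (∉-cut⇒< (d x y) p∉ r∈) (∉-cut⇒< (d y z) q∉ s∈))

      closedBall-sym : ∀ {q x y} → y ∈ closedBall q x → x ∈ closedBall q y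
      closedBall-sym {x = x} {y} q∉ = q∉ ∘ proj₁ (d-sym y x)

      open⇒closedBall⊆ : ∀ {V y} → IsOpen Y V → y ∈ V → ∃[ q ] (0ℚ ℚ.< q × closedBall q y ⊆ V)
      open⇒closedBall⊆ {V} {y} oV yV with to (metrizes V) oV y yV
      ... | ε , 0<ε , ⊆V with positive-rational ε 0<ε
      ...   | q , 0<q , q∈ = q , 0<q , λ q∉ → ⊆V (q , q∉ , q∈)

      ball-open : ∀ y q → IsOpen Y (ball d y (rational q))
      ball-open y q = from (metrizes _) λ x (r , r∉ , r<q) →
        -- As `r < q` bounds the distance from `y` to `x`, this is the room left around `x`.
        rational (q ℚ.+ ℚ.- r) ,
        (0ℚ , ℚ.<-irrefl refl ,
          subst (ℚ._< q ℚ.+ ℚ.- r) (ℚ.+-inverseʳ r) (ℚ.+-monoˡ-< (ℚ.- r) r<q)) ,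
        λ {z} (s , s∉ , s<q-r) → r ℚ.+ s , closedBall-triangle r∉ s∉ ,
          subst (r ℚ.+ s ℚ.<_) (cancel r) (ℚ.+-monoʳ-< r s<q-r)
        where
        cancel : ∀ r → r ℚ.+ (q ℚ.+ ℚ.- r) ≡ q
        cancel r = trans (ℚ.+-comm r _) (trans (ℚ.+-assoc q (ℚ.- r) r)
          (trans (cong (q ℚ.+_) (ℚ.+-inverseˡ r)) (ℚ.+-identityʳ q)))

      dense-closedBall : ∀ {q} → 0ℚ ℚ.< q → ∀ y → ∃[ x ] (x ∈ D × x ∈ closedBall q y)
      dense-closedBall {q} 0<q y with dense {y} tt (ball d y (rational q)) (ball-open y q)
                                  (0ℚ , (λ 0∈ → ℚ.<-irrefl refl (proj₁ (≈⇒0 refl) 0∈)) , 0<q)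
      ... | x , (r , r∉ , r<q) , x∈D = x , x∈D , ∉-cut-mono (d y x) (ℚ.<⇒≤ r<q) r∉

    Clopen⊆ : Pred (Carrier Y) 0ℓ → Pred (Pred (Carrier Y) 0ℓ) (suc 0ℓ)
    Clopen⊆ V C = IsOpen Y C × Closed Y C × C ⊆ V

    -- The tests `c k` turn membership in an open set into a search with locally constant steps,
    -- which the counter can carry out.
    open⇒⋃clopen : ∀ V → IsOpen Y V → Σ[ c ∈ (ℕ → Carrier Y → Bool) ]
      ((∀ k → LocallyConstant Y (c k)) × (∀ {k y} → T (c k y) → y ∈ V) ×
       (∀ {y} → y ∈ V → ∃[ k ] T (c k y)))
    open⇒⋃clopen V oV =
      c , (λ k → LC-any< Y k λ a → LC-any< Y k λ b → LC-piece a b) , (λ {k} → sound {k}) , complete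
      where
      -- As code is injective on D, a and b determine one ball, and the choice of a
      -- single clopen set above each such ball exhausts V.
      Suitable : ℕ → ℕ → Pred (Pred (Carrier Y) 0ℓ) (suc 0ℓ)
      Suitable a b C = Clopen⊆ V C × (∀ x → x ∈ D → code x ≡ a → closedBall (unitFraction b) x ⊆ C)

      -- The witness from `em` depends on `a` and `b` alone, not on `y`, so `em` acts as a choice
      -- function here. The default is the empty set.
      piece : ℕ → ℕ → Carrier Y → Bool
      piece a b y with em {∃ (Suitable a b)}
      ... | yes (C , _) = ⌊ em₀ {y ∈ C} ⌋
      ... | no _ = false

      LC-piece : ∀ a b → LocallyConstant Y (piece a b)
      LC-piece a b y with em {∃ (Suitable a b)}
      ... | no _ = LC-const Y false y
      ... | yes (C , (oC , (C′ , oC′ , C′≐) , _) , _) with em₀ {y ∈ C}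
      ...   | yes y∈ = C , oC , y∈ , λ z∈ → trans (isYes≗does em₀) (dec-true em₀ z∈)
      ...   | no  y∉ = C′ , oC′ , proj₂ C′≐ y∉ ,
        λ z∈ → trans (isYes≗does em₀) (dec-false em₀ (proj₁ C′≐ z∈))

      piece-sound : ∀ a b {y} → T (piece a b y) → y ∈ V
      piece-sound a b {y} h with em {∃ (Suitable a b)}
      ... | yes (C , (_ , _ , C⊆V) , _) = C⊆V (toWitness h)

      piece-complete : ∀ {y} → y ∈ V → ∃[ a ] ∃[ b ] T (piece a b y)
      piece-complete {y} y∈V with zero-dim V oV y y∈V
      ... | C , oC , clC , y∈C , C⊆V with open⇒closedBall⊆ oC y∈C
      -- Two radii `unitFraction b` fit into `q`: one leads from `y` to a point `x` of `D`, the
      -- other spans the ball about `x`, which therefore lies in `C`.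
      ...   | q , 0<q , ⊆C with halve 0<q
      ...     | b , b+b≤q with dense-closedBall (unitFraction-positive b) y
      ...       | x , x∈D , x∈ball = code x , b , T-piece
        where
        u = unitFraction b
        suitable : Suitable (code x) b C
        suitable = (oC , clC , C⊆V) , λ x′ x′∈D eq {z} z∈ →
          ⊆C (∉-cut-mono (d y z) b+b≤q (closedBall-triangle {u} {u} {y} {x} {z} x∈ball
            (subst (λ x → z ∈ closedBall u x) (code-injective x′∈D x∈D eq) z∈)))
        T-piece : T (piece (code x) b y)
        T-piece with em {∃ (Suitable (code x) b)}
        ... | yes (_ , _ , ⊆C) = fromWitness (⊆C x x∈D refl (closedBall-sym {u} {y} {x} x∈ball))
        ... | no none = contradiction (C , suitable) none

      -- Uniting the pieces with both indices below `k` makes one sequence out of a double one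
      -- without a pairing function.
      c : ℕ → Carrier Y → Bool
      c k y = any< k λ a → any< k λ b → piece a b y

      sound : ∀ {k y} → T (c k y) → y ∈ V
      sound {k} {y} h with any<⁻ k _ h
      ... | a , _ , h′ with any<⁻ k _ h′
      ...   | b , _ , h″ = piece-sound a b h″

      complete : ∀ {y} → y ∈ V → ∃[ k ] T (c k y)
      complete {y} y∈V = let a , b , h = piece-complete y∈V in
        1+ (a ⊔ b) , any<⁺ (λ a → any< _ (λ b → piece a b y)) (s≤s (ℕ.m≤m⊔n a b))
          (any<⁺ (λ b → piece a b y) (s≤s (ℕ.m≤n⊔m a b)) h)

    -- Row `n` of the table `c y` has a true entry exactly when `y` is outside `F n`. So for `y` in
    -- `B` some row stops the counter, and otherwise every row lets it pass.
    𝚺⁰₂⇒finite : ∀ B → 𝚺⁰₂ Y B → Σ[ h ∈ (Carrier Y → ℕ → Bool) ]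
      ((∀ n → LocallyConstant Y (λ y → h y n)) × (∀ y → y ∈ B → Finite (h y)) ×
       (∀ y → y ∉ B → Infinite (h y)))
    𝚺⁰₂⇒finite B (F , clF , B⊆ , ⊆B) =
      (λ y → hit (c y)) , LC-hit Y (λ n k y → c y n k) lc ,
      (λ y y∈B → let n , y∈F = B⊆ y∈B in ¬infinite⇒finite
        (unsolvable⇒¬infinite (c y) λ k ck → proj₁ (proj₂ (proj₂ (clF n))) (sound n {k} ck) y∈F)) ,
      (λ y y∉B → ¬finite⇒infinite (solvable⇒¬finite (c y) λ n →
        complete n (proj₂ (proj₂ (proj₂ (clF n))) λ y∈F → y∉B (⊆B (n , y∈F)))))
      where
      cover : ∀ n → _
      cover n = open⇒⋃clopen (proj₁ (clF n)) (proj₁ (proj₂ (clF n)))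
      c : Carrier Y → ℕ → ℕ → Bool
      c y n k = proj₁ (cover n) k y
      lc = λ n → proj₁ (proj₂ (cover n))
      sound = λ n {k} {y} → proj₁ (proj₂ (proj₂ (cover n))) {k} {y}
      complete = λ n {y} → proj₂ (proj₂ (proj₂ (cover n))) {y}

  -- Thin resolutions of non-empty open sets

  module _ (X : Space) where
    private
      Subset = Pred (Carrier X) 0ℓ

    Inside : Subset → Pred Subset (suc 0ℓ)
    Inside W V = IsOpen X V × Satisfiable V × V ⊆ W

    -- For open `W` this says that the trace of the singleton of `x` on `W` is nowhere dense in `W`.
    Evitable : Subset → Pred (Carrier X) (suc 0ℓ)
    Evitable W x = ∀ V → V ∈ Inside W → Σ[ V′ ∈ Subset ] (V′ ∈ Inside V × x ∉ V′)

    record ThinResolution : Set (suc (suc 0ℓ)) where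
      field
        W        : Subset
        W-open   : IsOpen X W
        W-inh    : Satisfiable W
        D        : Pred (Carrier X) (suc 0ℓ)
        D⊆W      : D ⊆ W
        evitable : D ⊆ Evitable W
        dense    : DenseIn X D W
        codense  : CodenseIn X D W

    Inside-trans : ∀ {V V′ W} → V ∈ Inside W → V′ ∈ Inside V → V′ ∈ Inside W
    Inside-trans (_ , _ , V⊆W) (oV′ , iV′ , V′⊆V) = oV′ , iV′ , V⊆W ∘ V′⊆V

    Inside-∩ : ∀ {V W x} → IsOpen X V → IsOpen X W → x ∈ V → x ∈ W → (V ∩ W) ∈ Inside W
    Inside-∩ oV oW xV xW = Space.open-∩ X oV oW , (_ , xV , xW) , proj₂

    Shrinkable : Subset → Set₁
    Shrinkable V = Σ[ V′ ∈ Subset ] (V′ ∈ Inside V × ∃[ x ] (x ∈ V × x ∉ V′))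

    record ShrinkableResolution : Set₁ where
      field
        A          : Subset
        W          : Subset
        W-open     : IsOpen X W
        W-inh      : Satisfiable W
        dense      : DenseIn X A W
        codense    : CodenseIn X A W
        shrinkable : ∀ V → V ∈ Inside W → Shrinkable V

    -- An open set that meets `V` contains it, as its trace on `V` would otherwise be smaller. So
    -- `a` and `b` witness density and codensity throughout `V`.
    minimal⇒¬monitorable : ∀ {χ V a b} → IsOpen X V → ¬ Shrinkable V →
      a ∈ V → b ∈ V → a ∈ ⟪ χ ⟫ → b ∉ ⟪ χ ⟫ → χ ∉ ℳ X
    minimal⇒¬monitorable {χ} {V} {a} {b} oV minimal a∈V b∈V χa ¬χb χ∈ℳ =
      [ (λ ¬dense   → ¬dense   λ x∈V O oO x∈O → a , contains oO x∈O x∈V a∈V , χa)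
      , (λ ¬codense → ¬codense λ x∈V O oO x∈O → b , contains oO x∈O x∈V b∈V , ¬χb)
      ]′ (χ∈ℳ V oV (a , a∈V))
      where
      contains : ∀ {O x y} → IsOpen X O → x ∈ O → x ∈ V → y ∈ V → y ∈ O
      contains {O} oO x∈O x∈V y∈V = stable₀ λ y∉O →
        minimal (O ∩ V , Inside-∩ oO oV x∈O x∈V , _ , y∈V , y∉O ∘ proj₁)

    -- Writing the sides as implications avoids deciding equality with `a` and `b`; off the support
    -- both are vacuous.
    separating : (a b : Carrier X) → Box {Carrier X} (λ _ → discrete Bool)
    separating a b = record
      { side      = λ x v → (x ≡ a → v ≡ true) × (x ≡ b → ¬ v ≡ true)
      ; side-open = λ _ → _
      ; support   = a ∷ b ∷ []
      ; side-full = λ x x∉ → _ , λ _ →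
          (λ { refl → contradiction (here refl) x∉ }) ,
          (λ { refl → contradiction (there (here refl)) x∉ })
      }

    -- A minimal non-empty open set on which χ takes both values would keep every
    -- function that agrees with χ at two of its points from being monitorable.
    ¬closed⇒shrinkableResolution : ¬ Closed (𝒫 (Carrier X)) (ℳ X) → ShrinkableResolution
    ¬closed⇒shrinkableResolution ¬closed = stable λ none →
      ¬closed (Complement , complement-open none , sound , complete)
      where
      -- Open sets are predicates in `Set`, while `χ ∉ ℳ X` lives one level higher, so `em` supplies
      -- its truth value.
      Complement : Pred (Carrier X → Bool) 0ℓ
      Complement χ = T (not (does (em {χ ∈ ℳ X})))

      sound : ∀ {χ} → χ ∈ Complement → χ ∉ ℳ X
      sound {χ} h with em {χ ∈ ℳ X}
      ... | no χ∉ = χ∉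

      complete : ∀ {χ} → χ ∉ ℳ X → χ ∈ Complement
      complete {χ} χ∉ with em {χ ∈ ℳ X}
      ... | yes χ∈ = χ∉ χ∈
      ... | no _   = tt

      complement-open : ¬ ShrinkableResolution → IsOpen (𝒫 (Carrier X)) Complement
      -- If no box around `χ` works, every non-empty open `W` on which `χ` is dense and codense
      -- gives a shrinkable resolution, against `none`; so `χ` would be monitorable.
      complement-open none χ χ∈ = stable λ noBox → sound χ∈ λ W oW inhW → stable λ res →
        let dense : DenseIn X ⟪ χ ⟫ W
            dense = stable {DenseIn X ⟪ χ ⟫ W} (res ∘ inj₁)
            codense : CodenseIn X ⟪ χ ⟫ W
            codense = stable {CodenseIn X ⟪ χ ⟫ W} (res ∘ inj₂)
        in none record
          { A = ⟪ χ ⟫ ; W = W ; W-open = oW ; W-inh = inhW ; dense = dense ; codense = codense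
          ; shrinkable = λ V (oV , (v , v∈V) , V⊆W) → stable λ minimal →
              let a , a∈V , χa  = dense (V⊆W v∈V) V oV v∈V
                  b , b∈V , ¬χb = codense (V⊆W v∈V) V oV v∈V
              in noBox (separating a b ,
                (λ x → (λ { refl → χa }) , (λ { refl → ¬χb })) ,
                λ {χ′} χ′∈ → complete (minimal⇒¬monitorable oV minimal a∈V b∈V
                  (proj₁ (χ′∈ a) refl) (proj₂ (χ′∈ b) refl)))
          }

    -- If some x lies in all non-empty open subsets of some non-empty open W, the
    -- evitable points of W are dense in it and omit x.  Otherwise all points are evitable.
    thin : ShrinkableResolution → ThinResolution
    thin R with em {∃[ x ] Σ[ W ∈ Subset ]
      (W ∈ Inside (ShrinkableResolution.W R) × (∀ V → V ∈ Inside W → x ∈ V))}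
    ... | yes (x , W , W∈@(oW , iW , _) , x∈all) = record
      { W = W ; W-open = oW ; W-inh = iW
      ; D = λ d → d ∈ W × d ∈ Evitable W
      ; D⊆W = proj₁
      ; evitable = proj₂
      ; dense = λ {y} y∈W V oV y∈V →
          let VW∈ = Inside-∩ oV oW y∈V y∈W
              V′ , V′∈ , d , (d∈V , d∈W) , d∉V′ = R.shrinkable (V ∩ W) (Inside-trans W∈ VW∈)
              oV′ , _ = V′∈
              x∈V′ = x∈all V′ (Inside-trans VW∈ V′∈)
          -- Both `V′` and `V″` contain `x`, so they meet, and `V′` already misses `d`.
          in d , d∈V , d∈W , λ V″ V″∈@(oV″ , _) →
            V′ ∩ V″ , Inside-∩ oV′ oV″ x∈V′ (x∈all V″ V″∈) , d∉V′ ∘ proj₁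
      ; codense = λ {y} y∈W V oV y∈V →
          x , proj₁ (x∈all (V ∩ W) (Inside-∩ oV oW y∈V y∈W)) ,
          λ (x∈W , ev) → let V′ , V′∈ , x∉V′ = ev W (oW , iW , id) in x∉V′ (x∈all V′ V′∈)
      }
      where module R = ShrinkableResolution R
    ... | no none = record
      { W = R.W ; W-open = R.W-open ; W-inh = R.W-inh
      ; D = λ d → (d ∈ R.W × d ∈ R.A) × d ∈ Evitable R.W
      ; D⊆W = proj₁ ∘ proj₁
      ; evitable = proj₂
      ; dense = λ y∈W V oV y∈V →
          let d , (d∈V , d∈W) , d∈A = R.dense y∈W (V ∩ R.W) (Space.open-∩ X oV R.W-open) (y∈V , y∈W)
          in d , d∈V , (d∈W , d∈A) , λ V V∈ → stable λ ¬ev →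
            none (d , V , V∈ , λ V′ V′∈ → stable₀ λ d∉V′ → ¬ev (V′ , V′∈ , d∉V′))
      ; codense = λ y∈W V oV y∈V →
          let x , x∈V , x∉A = R.codense y∈W V oV y∈V in x , x∈V , x∉A ∘ proj₂ ∘ proj₁
      }
      where module R = ShrinkableResolution R

    -- Coding sets of naturals by subsets of a thin resolution

    module Fill (index : Carrier X → ℕ) (point : ℕ → Carrier X)
                (point-index : ∀ x → point (index x) ≡ x) (B : SecondCountable X)
                (R : ThinResolution) where
      open ThinResolution R

      -- Evitability is applied once for each index below `n` whose point lies in `D`, shrinking the
      -- open set each time.
      avoid : ∀ n V → V ∈ Inside W →
        Σ[ V′ ∈ Subset ] (V′ ∈ Inside V × (∀ {x} → x ∈ D → index x < n → x ∉ V′))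
      avoid zero V (oV , iV , _) = V , (oV , iV , id) , λ _ ()
      avoid (1+ n) V V∈ with avoid n V V∈
      ... | V₁ , V₁∈ , V₁-avoids with em {point n ∈ D}
      ...   | no n∉D = V₁ , V₁∈ , λ {x} x∈D i<1+n →
        [ V₁-avoids x∈D
        , (λ { refl → contradiction (subst (_∈ D) (sym (point-index x)) x∈D) n∉D }) ]′
        (ℕ.m≤n⇒m<n∨m≡n (ℕ.≤-pred i<1+n))
      ...   | yes n∈D with evitable n∈D V₁ (Inside-trans V∈ V₁∈)
      ...     | V₂ , V₂∈@(_ , _ , V₂⊆V₁) , n∉V₂ =
        V₂ , Inside-trans V₁∈ V₂∈ , λ {x} x∈D i<1+n x∈V₂ →
        [ (λ i<n → V₁-avoids x∈D i<n (V₂⊆V₁ x∈V₂))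
        , (λ { refl → n∉V₂ (subst (_∈ V₂) (sym (point-index x)) x∈V₂) }) ]′
        (ℕ.m≤n⇒m<n∨m≡n (ℕ.≤-pred i<1+n))

      -- Basic sets that are empty or leave `W` are replaced by `W`, so that every entry is a
      -- non-empty open subset of `W`.
      π-base : ∀ n → Σ[ V ∈ Subset ]
        (V ∈ Inside W × (proj₁ B n ∈ Inside W → V ⊆ proj₁ B n))
      π-base n with em {proj₁ B n ∈ Inside W}
      ... | yes Bn∈ = proj₁ B n , Bn∈ , λ _ → id
      ... | no  Bn∉ = W , (W-open , W-inh , id) , λ Bn∈ → contradiction Bn∈ Bn∉

      -- Shrink the `i`-th entry to avoid the points of `D` with index up to `n`, hence `1+ n`;
      -- density of `D` then supplies a point with a larger index.
      late : ∀ n i → ∃[ x ] (x ∈ D × n < index x × x ∈ proj₁ (π-base i))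
      late n i with π-base i
      ... | V , V∈ , _ with avoid (1+ n) V V∈
      ...   | V′ , (oV′ , (v , v∈V′) , V′⊆V) , V′-avoids
              with dense (proj₂ (proj₂ V∈) (V′⊆V v∈V′)) V′ oV′ v∈V′
      ...     | x , x∈V′ , x∈D =
        x , x∈D , ℕ.≰⇒> (λ i≤n → V′-avoids x∈D (s≤s i≤n) x∈V′) , V′⊆V x∈V′

      inBlock : ℕ → Carrier X → Bool
      inBlock n x = any< (1+ n) λ i → ⌊ em₀ {x ≡ proj₁ (late n i)} ⌋

      -- The union of the blocks { late n i | i ≤ n } over n ∈ h.  Stopping the search at
      -- index x loses nothing, since late n i has index beyond n, and makes
      -- membership of x depend on h continuously.
      fill : (ℕ → Bool) → Carrier X → Bool
      fill h x = any< (index x) λ n → h n ∧ inBlock n x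

      fill⁺ : ∀ {h n i} → T (h n) → i ≤ n → proj₁ (late n i) ∈ ⟪ fill h ⟫
      fill⁺ {h} {n} {i} hn i≤n = to T-≡ (any<⁺ (λ m → h m ∧ inBlock m x)
        (proj₁ (proj₂ (proj₂ (late n i))))
        (from T-∧ (hn , any<⁺ (λ j → ⌊ em₀ {x ≡ proj₁ (late n j)} ⌋) (s≤s i≤n) (fromWitness refl))))
        where x = proj₁ (late n i)

      fill⁻ : ∀ {h x} → x ∈ ⟪ fill h ⟫ → ∃[ n ] ∃[ i ] (T (h n) × i ≤ n × x ≡ proj₁ (late n i))
      fill⁻ {h} {x} χx =
        let n , _ , hn∧ = any<⁻ (index x) _ (from T-≡ χx)
            hn , any = to T-∧ hn∧
            i , i<1+n , eq = any<⁻ (1+ n) _ any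
        in n , i , hn , ℕ.≤-pred i<1+n , toWitness eq

      fill⊆D : ∀ {h x} → x ∈ ⟪ fill h ⟫ → x ∈ D
      fill⊆D χx = let n , i , _ , _ , eq = fill⁻ χx in
        subst (_∈ D) (sym eq) (proj₁ (proj₂ (late n i)))

      LC-fill : (Y : Space) {h : Carrier Y → ℕ → Bool} →
        (∀ n → LocallyConstant Y (λ y → h y n)) →
        ∀ x → LocallyConstant Y (λ y → fill (h y) x)
      LC-fill Y lh x = LC-any< Y (index x) λ n → LC-map Y (_∧ inBlock n x) (lh n)

      -- Only blocks with number below `N` contribute, and each of them is finite.
      fill-bounded : ∀ {h} → Finite h → ∃[ M ] ∀ {x} → x ∈ ⟪ fill h ⟫ → index x < M
      fill-bounded (N , none) =
        let M , bound = upperBound (λ n → proj₁ (row n)) N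
        in M , λ χx → lemma M bound (fill⁻ χx)
        where
        row : ∀ n → ∃[ M ] ∀ i → i < 1+ n → index (proj₁ (late n i)) < M
        row n = upperBound (λ i → index (proj₁ (late n i))) (1+ n)
        lemma : ∀ M → (∀ n → n < N → proj₁ (row n) < M) → ∀ {x} → _ → index x < M
        lemma M bound (n , i , hn , i≤n , refl) = ℕ.<-trans (proj₂ (row n) i (s≤s i≤n))
          (bound n (ℕ.≰⇒> λ N≤n → none n N≤n hn))

      -- The set is nowhere dense: a `V` disjoint from `W` misses it outright, and otherwise `V ∩ W`
      -- shrinks past the bound on its indices.
      finite⇒monitorable : ∀ {h} → Finite h → fill h ∈ ℳ X
      finite⇒monitorable {h} fin V oV (v , v∈V) = inj₁ λ fill-dense →
        let V′ , oV′ , (v′ , v′∈V′) , V′⊆V , V′-avoids = hole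
            x , x∈V′ , χx = fill-dense (V′⊆V v′∈V′) V′ oV′ v′∈V′
        in V′-avoids χx x∈V′
        where
        hole : Σ[ V′ ∈ Subset ]
          (IsOpen X V′ × Satisfiable V′ × V′ ⊆ V × (∀ {x} → x ∈ ⟪ fill h ⟫ → x ∉ V′))
        hole with em₀ {∃[ x ] (x ∈ V × x ∈ W)}
        ... | no disjoint = V , oV , (v , v∈V) , id ,
          λ χx x∈V → disjoint (_ , x∈V , D⊆W (fill⊆D χx))
        ... | yes (x , x∈V , x∈W) =
          let M , bound = fill-bounded fin
              V′ , (oV′ , iV′ , V′⊆) , V′-avoids = avoid M (V ∩ W) (Inside-∩ oV W-open x∈V x∈W)
          in V′ , oV′ , iV′ , proj₁ ∘ V′⊆ , λ χx → V′-avoids (fill⊆D χx) (bound χx)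

      -- Codensity passes from `D` to its subset. For density, any `n ≥ i` in `h` contributes a
      -- point of the `i`-th member of the π-base.
      infinite⇒¬monitorable : ∀ {h} → Infinite h → fill h ∉ ℳ X
      infinite⇒¬monitorable inf mon with mon W W-open W-inh
      ... | inj₂ ¬codense = ¬codense λ y∈W V oV y∈V →
        let x , x∈V , x∉D = codense y∈W V oV y∈V in x , x∈V , x∉D ∘ fill⊆D
      ... | inj₁ ¬dense = ¬dense λ {y} y∈W V oV y∈V →
        let i , y∈Bi , Bi⊆ = proj₂ (proj₂ B) (V ∩ W) (Space.open-∩ X oV W-open) y (y∈V , y∈W)
            n , i≤n , hn = inf i
            x , _ , _ , x∈ = late n i
            Bi-inside : proj₁ B i ∈ Inside W
            Bi-inside = proj₁ (proj₂ B) i , (y , y∈Bi) , proj₂ ∘ Bi⊆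
        in x , proj₁ (Bi⊆ (proj₂ (proj₂ (π-base i)) Bi-inside x∈)) , fill⁺ hn i≤n

theorem3p4 : ExcludedMiddle (suc 0ℓ) →
    (X : Space) → CountablyInfinite (Carrier X) → SecondCountable X →
    ¬ Closed (𝒫 (Carrier X)) (ℳ X) →
    Hard 𝚺⁰₂ (𝒫 (Carrier X)) (ℳ X)
theorem3p4 em X count B ¬closed Y polish zero-dim A A∈𝚺⁰₂ =
  (λ y → fill (h y)) ,
  LC⇒continuous Y (λ y → fill (h y)) (LC-fill Y lc) ,
  (λ {y} y∈A → finite⇒monitorable (fin y y∈A)) ,
  (λ {y} mon → stable₀ λ y∉A → infinite⇒¬monitorable (inf y y∉A) mon)
  where
  open Classical em
  open Bijection count using (to⁻; strictlySurjective) renaming (to to point)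
  open Fill X to⁻ point (proj₂ ∘ strictlySurjective) B
    (thin X (¬closed⇒shrinkableResolution X ¬closed))
  reduction = 𝚺⁰₂⇒finite Y polish zero-dim A A∈𝚺⁰₂
  h = proj₁ reduction
  lc = proj₁ (proj₂ reduction)
  fin = proj₁ (proj₂ (proj₂ reduction))
  inf = proj₂ (proj₂ (proj₂ reduction))
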